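{- Let $\Gamma_1$ be a non-empty set of cycles and let $\Gamma_2$ be a (possibly empty) set of cycles of length at least $5$. Let $R_1=R(\Gamma_1,\{C_4\}\cup\Gamma_2)$ and $R_2=R(\Gamma_1,\{C_3,C_4\}\cup\Gamma_2)$. If every cycle in $\Gamma_1$ has length at least $6$, then $R_1=R_2$. In particular, $R(\{C_n\},\{C_4\})=R(\{C_n\},\{C_3,C_4\})$ whenever $n\geq 6$.
   Context: All graphs are finite, simple and undirected; $C_k$ ($k\ge 3$) is the cycle of length $k$. A red-blue graph is a complete graph with each edge coloured red or blue. For non-empty sets $\mathcal G_1,\mathcal G_2$ of non-empty graphs, $R(\mathcal G_1,\mathcal G_2)$ is the least positive integer $N$ such that each red-blue graph on $N$ vertices contains a red subgraph from $\mathcal G_1$ or a blue subgraph from $\mathcal G_2$. -}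

module Defs where

open import Level using (Level; 0ℓ)
open import Data.Nat using (ℕ; suc; _≤_)
open import Data.Fin using (Fin; toℕ)
open import Data.Product using (Σ; ∃-syntax; _×_; _,_)
open import Data.Sum using (_⊎_; swap)
open import Function using (_↔_; _⇔_; Inverse; Injective)
open import Relation.Binary using (Rel; Symmetric; Irreflexive)
open import Relation.Binary.PropositionalEquality using (_≡_; _≢_; sym; trans; ≢-sym)
open import Relation.Unary using (Pred)

private
  variable
    ℓ ℓ₁ ℓ₂ : Level

record Graph : Set₁ where
  field
    order      : ℕ
    Adj        : Rel (Fin order) 0ℓ
    adj-sym    : Symmetric Adj
    adj-irrefl : Irreflexive _≡_ Adj

open Graph public

GraphSet : ∀ ℓ → Set _
GraphSet ℓ = Pred Graph ℓ

infix 4 _≅_ _⊑_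

_≅_ : Graph → Graph → Set
G ≅ H = Σ (Fin (order G) ↔ Fin (order H)) λ f →
  ∀ i j → Adj G i j ⇔ Adj H (Inverse.to f i) (Inverse.to f j)

-- H has a (not necessarily induced) subgraph isomorphic to G.
_⊑_ : Graph → Graph → Set
G ⊑ H = Σ (Fin (order G) → Fin (order H)) λ f →
  Injective _≡_ _≡_ f × (∀ {i j} → Adj G i j → Adj H (f i) (f j))

Next : ∀ {k} → Rel (Fin k) 0ℓ
Next {k} i j = toℕ j ≡ suc (toℕ i) ⊎ (suc (toℕ i) ≡ k × toℕ j ≡ 0)

-- The cycle on k vertices when 3 ≤ k.  Only those values of k are meaningful;
-- the condition i ≢ j is automatic for them and merely removes the loop at k = 1.
C : ℕ → Graph
C k = record
  { order      = k
  ; Adj        = λ i j → i ≢ j × (Next i j ⊎ Next j i)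
  ; adj-sym    = λ (i≢j , n) → ≢-sym i≢j , swap n
  ; adj-irrefl = λ i≡j (i≢j , _) → i≢j i≡j
  }

CycleOfLength : ℕ → GraphSet 0ℓ
CycleOfLength k G = 3 ≤ k × G ≅ C k

Cycle : GraphSet 0ℓ
Cycle G = ∃[ k ] CycleOfLength k G

LengthsAtLeast : ℕ → GraphSet ℓ → Set _
LengthsAtLeast m Γ = ∀ {G k} → Γ G → CycleOfLength k G → m ≤ k

data Colour : Set where
  red blue : Colour

-- The diagonal values of colour carry no information: they are discarded by
-- the condition i ≢ j in _[_] below.
record RedBlueGraph (N : ℕ) : Set where
  field
    colour     : Fin N → Fin N → Colour
    colour-sym : ∀ i j → colour i j ≡ colour j i

open RedBlueGraph public

-- The spanning subgraph formed by the edges of colour c.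
_[_] : ∀ {N} → RedBlueGraph N → Colour → Graph
_[_] {N} X c = record
  { order      = N
  ; Adj        = λ i j → i ≢ j × colour X i j ≡ c
  ; adj-sym    = λ {i} {j} (i≢j , e) → ≢-sym i≢j , trans (colour-sym X j i) e
  ; adj-irrefl = λ i≡j (i≢j , _) → i≢j i≡j
  }

Contains : Graph → GraphSet ℓ → Set _
Contains H 𝒢 = ∃[ G ] (𝒢 G × G ⊑ H)

Arrows : ℕ → GraphSet ℓ₁ → GraphSet ℓ₂ → Set _
Arrows N 𝒢₁ 𝒢₂ =
  (X : RedBlueGraph N) → Contains (X [ red ]) 𝒢₁ ⊎ Contains (X [ blue ]) 𝒢₂

-- N = R(𝒢₁, 𝒢₂).  This is a relation rather than a function because for an
-- arbitrary predicate the least such N cannot be computed constructively.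
IsRamseyNumber : GraphSet ℓ₁ → GraphSet ℓ₂ → ℕ → Set _
IsRamseyNumber 𝒢₁ 𝒢₂ N =
  1 ≤ N × Arrows N 𝒢₁ 𝒢₂ × (∀ M → 1 ≤ M → Arrows M 𝒢₁ 𝒢₂ → N ≤ M)

{-# OPTIONS --safe #-}
module Submission where

-- It suffices that every red-blue graph X with no blue C₄ and a blue triangle abc
-- either has a red cycle of an admissible length k ≥ 6, or stays without one after
-- some edge of abc is recoloured red; recolouring then destroys all blue triangles.
-- As there is no blue C₄, every other vertex is blue to at most one of a, b, c. So if
-- recolouring ab creates a red k-cycle through ab, rerouting it through a, b and c
-- yields a red k-cycle of X itself, unless it contains c and one of a, b, say a, is
-- blue to all other vertices of the cycle but one ("a is bad"). If every edge of abc fails in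
-- this way, two of its vertices, say a and b, are bad: there are red paths P and P′,
-- with k − 4 vertices in total, inside the blue neighbourhood of a, and two blue
-- neighbours r, s of b off the triangle. Then b P r a s P′ or b P s a r P′ is a red
-- k-cycle.

open import Defs renaming (_[_] to _⟦_⟧)
open import Data.Bool using (if_then_else_; _∧_; _∨_)
open import Data.Bool.Properties using (∨-comm; ∧-comm)
open import Data.Empty using (⊥)
open import Data.Fin using (Fin; zero; suc; toℕ; fromℕ; inject₁)
open import Data.Fin.Properties using (_≟_; any?; toℕ-fromℕ; toℕ-inject₁)
open import Data.List
  using (List; []; _∷_; _++_; [_]; length; lookup; tabulate; filter; allFin; cartesianProduct)
open import Data.List.Membership.Propositional using (_∈_; _∉_)
open import Data.List.Membership.Propositional.Properties
  using (∈-++⁺ˡ; ∈-++⁺ʳ; ∈-lookup; ∈-filter⁺; ∈-allFin; ∈-cartesianProduct⁺)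
open import Data.List.Properties using (filter-notAll; length-tabulate)
open import Data.List.Relation.Binary.Permutation.Propositional
  using (_↭_; ↭-refl; ↭-sym; ↭-trans; prep; swap; ↭⇒↭ₛ)
open import Data.List.Relation.Binary.Permutation.Propositional.Properties
  using (↭-length; ∈-resp-↭; All-resp-↭; ++-comm; ++-assoc; ++⁺ˡ; ++⁺ʳ; ∷↭∷ʳ; ++-commutativeMonoid)
  renaming (++⁺ to ++-cong)
import Data.List.Relation.Binary.Permutation.Setoid.Properties as Permutationₛ
open import Data.List.Relation.Unary.All as All using (All; []; _∷_)
open import Data.List.Relation.Unary.All.Properties using (++⁺; ++⁻ˡ; ++⁻ʳ)
open import Data.List.Relation.Unary.AllPairs using ([]; _∷_)
open import Data.List.Relation.Unary.Any as Any using (Any; here; there)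
open import Data.List.Relation.Unary.Unique.Propositional using (Unique)
import Data.List.Relation.Unary.Unique.Propositional.Properties as Unique
open import Data.Nat using (ℕ; zero; suc; _≤_; _<_; z≤n; s≤s)
open import Data.Nat.Properties
  using (≤-refl; ≤-trans; ≤-antisym; <-≤-trans; n≤1+n; 1+n≢n; suc-injective)
open import Data.Product using (∃₂; ∃-syntax; _×_; _,_; proj₁; proj₂)
open import Data.Sum as Sum using (_⊎_; inj₁; inj₂)
open import Function using (_∘_; id; Inverse; Injection; Equivalence)
open import Function.Construct.Identity using (↔-id; ⇔-id)
open import Function.Construct.Symmetry using (↔-sym)
open import Function.Properties.Inverse using (↔⇒↣)
open import Level using (Level; 0ℓ)
open import Relation.Binary using (Rel; Symmetric; Irreflexive; Decidable; DecidableEquality)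
open import Relation.Binary.PropositionalEquality
  using (_≡_; _≢_; refl; sym; trans; cong; cong₂; subst; subst₂; ≢-sym; setoid)
open import Relation.Nullary using (¬_; Dec; yes; no; does; contradiction; ¬?)
open import Relation.Nullary.Decidable using (decidable-stable; _×-dec_; _⊎-dec_)
open import Relation.Unary using (Pred; _∪_; _⊆_; ｛_｝; Satisfiable)
import Relation.Unary as U

import Algebra.Solver.CommutativeMonoid as CMSolver

private
  variable
    ℓ : Level
    V : Set
    E : Rel V 0ℓ
    a b c s t u v w x y z : V
    l m P P₁ Q Q₁ W W₁ W₂ : List V

-- Paths and cycles as vertex lists

Unique-resp-↭ : l ↭ m → Unique l → Unique m
Unique-resp-↭ σ = Permutationₛ.Unique-resp-↭ (setoid _) (↭⇒↭ₛ σ)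

data Path {V : Set} (E : Rel V 0ℓ) : V → V → List V → Set where
  stop : ∀ x → Path E x x [ x ]
  _∷_  : E x y → Path E y z l → Path E x z (x ∷ l)

-- The list of a segment is only a multiset of vertices, so that it does not
-- change under reversal.
Seg : Rel V 0ℓ → V → V → List V → Set
Seg E x y l = ∃[ m ] Path E x y m × m ↭ l

Closed : Rel V 0ℓ → List V → Set
Closed E l = ∃₂ λ x y → Seg E x y l × E y x

Seg-resp-↭ : l ↭ m → Seg E x y l → Seg E x y m
Seg-resp-↭ σ (k , p , τ) = k , p , ↭-trans τ σ

Closed-resp-↭ : l ↭ m → Closed E l → Closed E m
Closed-resp-↭ σ (x , y , p , r) = x , y , Seg-resp-↭ σ p , r

⟨_⟩ : (x : V) → Seg E x x [ x ]
⟨ x ⟩ = [ x ] , stop x , ↭-refl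

joinPath : Path E x y l → E y z → Path E z w m → Path E x w (l ++ m)
joinPath (stop _) r p = r ∷ p
joinPath (e ∷ q)  r p = e ∷ joinPath q r p

infixr 5 _—⟨_⟩—_

_—⟨_⟩—_ : Seg E x y l → E y z → Seg E z w m → Seg E x w (l ++ m)
(_ , p , σ) —⟨ r ⟩— (_ , q , τ) = _ , joinPath p r q , ++-cong σ τ

start∈ : Seg E x y l → x ∈ l
start∈ (_ , stop _ , σ) = ∈-resp-↭ σ (here refl)
start∈ (_ , _ ∷ _ , σ)  = ∈-resp-↭ σ (here refl)

uncons : Seg E x y l →
  (x ≡ y × [ x ] ↭ l) ⊎ (∃₂ λ w m → E x w × Seg E w y m × [ x ] ++ m ↭ l)
uncons (_ , stop _ , σ) = inj₁ (refl , σ)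
uncons (_ , r ∷ p , σ)  = inj₂ (_ , _ , r , (_ , p , ↭-refl) , σ)

-- A path split at an edge `p q` that leaves `A`. Mostly `A` is blue adjacency to a triangle vertex,
-- so that vertex is blue to `p` and red to `q`.
record Exit (E : Rel V 0ℓ) (A : Pred V 0ℓ) (x y : V) (l : List V) : Set where
  constructor exit
  field
    {p q}   : V
    {l₁ l₂} : List V
    before  : Seg E x p l₁
    inside  : A p
    edge    : E p q
    outside : ¬ A q
    after   : Seg E q y l₂
    split   : l₁ ++ l₂ ↭ l

module _ {E : Rel V 0ℓ} {A : Pred V 0ℓ} (A? : U.Decidable A) where

  spreadPath : Path E x y l → A x → All A l ⊎ Exit E A x y l
  spreadPath (stop x) ax = inj₁ (ax ∷ [])
  spreadPath {x = x} (_∷_ {y = z} r p) ax with A? z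
  ... | no ¬az = inj₂ (exit ⟨ x ⟩ ax r ¬az (_ , p , ↭-refl) ↭-refl)
  ... | yes az = Sum.map (ax ∷_) extend (spreadPath p az)
    where
    extend : Exit E A z _ _ → Exit E A x _ _
    extend (exit b ap e ¬aq f σ) = exit (⟨ x ⟩ —⟨ r ⟩— b) ap e ¬aq f (prep x σ)

  spread : Seg E x y l → A x → All A l ⊎ Exit E A x y l
  spread (_ , p , σ) ax = Sum.map (All-resp-↭ σ) transport (spreadPath p ax)
    where
    transport : Exit E A _ _ _ → Exit E A _ _ _
    transport (exit b ap e ¬aq f τ) = exit b ap e ¬aq f (↭-trans τ σ)

module _ {E : Rel V 0ℓ} (E-sym : Symmetric E) where

  rev : Seg E x y l → Seg E y x l
  rev (_ , p , σ) = Seg-resp-↭ σ (revPath p)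
    where
    revPath : Path E x y l → Seg E y x l
    revPath (stop x) = ⟨ x ⟩
    revPath {l = x ∷ l} (r ∷ p) = Seg-resp-↭ (++-comm l [ x ]) (revPath p —⟨ E-sym r ⟩— ⟨ x ⟩)

  end∈ : Seg E x y l → y ∈ l
  end∈ = start∈ ∘ rev

  unsnoc : Seg E x y l →
    (x ≡ y × [ x ] ↭ l) ⊎ (∃₂ λ w m → Seg E x w m × E w y × m ++ [ y ] ↭ l)
  unsnoc {y = y} p with uncons (rev p)
  ... | inj₁ (refl , σ)            = inj₁ (refl , σ)
  ... | inj₂ (w , m , r , q , σ)   = inj₂ (w , m , rev q , E-sym r , ↭-trans (++-comm m [ y ]) σ)

  -- The exchange from the theorems of Dirac and Ore: in a path `b … x y … a` the edge `x y` gives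
  -- way to the chords `x a` and `y b`.
  crossing : Seg E b x l → E x a → Seg E y a m → E y b → Closed E (l ++ m)
  crossing p xa q yb = _ , _ , p —⟨ xa ⟩— rev q , yb

Unique-++-apart : ∀ l → Unique (l ++ m) → x ∈ l → y ∈ m → x ≢ y
Unique-++-apart (_ ∷ l) (f ∷ _) (here refl) y∈ = All.lookup (++⁻ʳ l f) y∈
Unique-++-apart (_ ∷ l) (_ ∷ u) (there x∈)  y∈ = Unique-++-apart l u x∈ y∈

Unique-++⁻ : ∀ l → Unique (l ++ m) → Unique l × Unique m
Unique-++⁻ []      u       = [] , u
Unique-++⁻ (_ ∷ l) (f ∷ u) = (++⁻ˡ l f ∷ proj₁ (Unique-++⁻ l u)) , proj₂ (Unique-++⁻ l u)

-- Undoing a recoloured edge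

Joins : V → V → V → V → Set
Joins a b x y = (x ≡ a × y ≡ b) ⊎ (x ≡ b × y ≡ a)

module Reopening {R E : Rel V 0ℓ} (R-sym : Symmetric R) {a b : V}
  (old : ∀ {x y} → E x y → R x y ⊎ Joins a b x y) where

  Cut : V → V → V → V → List V → Set
  Cut p q x y l = ∃₂ λ l₁ l₂ → Seg R x p l₁ × Seg R q y l₂ × l₁ ++ l₂ ↭ l

  -- Every copy of the edge `a b` has `w` as an end, so a path that misses `w` cannot use it.
  avoid : ∀ {w} → (∀ {x y} → Joins a b x y → x ≡ w ⊎ y ≡ w) → w ∉ l → Path E x y l → Path R x y l
  avoid touches w∉ (stop x) = stop x
  avoid touches w∉ (_∷_ {y = z} e p) with old e
  ... | inj₁ r = r ∷ avoid touches (w∉ ∘ there) p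
  ... | inj₂ j with touches j
  ...   | inj₁ refl = contradiction (here refl) w∉
  ...   | inj₂ refl = contradiction (there (start∈ (_ , p , ↭-refl))) w∉

  -- A path without repeated vertices uses the edge `a b` at most once; the two `Cut` cases record
  -- the direction of traversal.
  cutPath : Unique l → Path E x y l → Path R x y l ⊎ Cut a b x y l ⊎ Cut b a x y l
  cutPath _ (stop x) = inj₁ (stop x)
  cutPath (f ∷ u) (_∷_ {x = x} e p) with old e
  ... | inj₁ r = Sum.map (r ∷_) (Sum.map (extend r) (extend r)) (cutPath u p)
    where
    extend : ∀ {p q z y l} → R x z → Cut p q z y l → Cut p q x y (x ∷ l)
    extend r (l₁ , l₂ , s , t , σ) = x ∷ l₁ , l₂ , ⟨ x ⟩ —⟨ r ⟩— s , t , prep x σ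
  ... | inj₂ (inj₁ (refl , refl)) = inj₂ (inj₁ (_ , _ , ⟨ x ⟩ ,
    (_ , avoid (Sum.map proj₁ proj₂) (λ x∈ → All.lookup f x∈ refl) p , ↭-refl) , ↭-refl))
  ... | inj₂ (inj₂ (refl , refl)) = inj₂ (inj₂ (_ , _ , ⟨ x ⟩ ,
    (_ , avoid (Sum.swap ∘ Sum.map proj₂ proj₁) (λ x∈ → All.lookup f x∈ refl) p , ↭-refl) , ↭-refl))

  loop : Unique l → Seg R x x l → [ x ] ↭ l
  loop u p with uncons p
  ... | inj₁ (_ , σ) = σ
  ... | inj₂ (_ , _ , _ , q , σ) with Unique-resp-↭ (↭-sym σ) u
  ...   | f ∷ _ = contradiction refl (All.lookup f (end∈ R-sym q))

  glue : ∀ {p q} → Unique l → 3 ≤ length l → Cut p q x y l → R y x ⊎ Joins p q y x → Seg R q p l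
  glue u 3≤ (l₁ , l₂ , s , t , σ) (inj₁ r) =
    Seg-resp-↭ (↭-trans (++-comm l₂ l₁) σ) (t —⟨ r ⟩— s)
  -- The closing edge runs along the cut edge in the same direction, so `p` would end both of the
  -- disjoint pieces.
  glue u 3≤ (l₁ , l₂ , s , t , σ) (inj₂ (inj₁ (refl , refl))) =
    contradiction refl
      (Unique-++-apart l₁ (Unique-resp-↭ (↭-sym σ) u) (end∈ R-sym s) (end∈ R-sym t))
  -- In the opposite direction both pieces are loops, hence single vertices, and the list has length
  -- two.
  glue u 3≤ (l₁ , l₂ , s , t , σ) (inj₂ (inj₂ (refl , refl)))
    with Unique-++⁻ l₁ (Unique-resp-↭ (↭-sym σ) u)
  ... | u₁ , u₂
    with s≤s (s≤s ()) ← subst (3 ≤_)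
           (sym (↭-length (↭-trans (++-cong (loop u₁ s) (loop u₂ t)) σ))) 3≤

  -- A cycle that uses the recoloured edge uses it once, and rotating the cycle makes it the closing
  -- edge; the rest is an `R`-path between its ends.
  reopen : Unique l → 3 ≤ length l → Closed E l → Closed R l ⊎ Seg R b a l
  reopen {l} u 3≤ (x , y , (m , p , σ) , e)
    with cutPath (Unique-resp-↭ (↭-sym σ) u) p | old e
  ... | inj₁ p′ | inj₁ r = inj₁ (x , y , (m , p′ , σ) , r)
  ... | inj₁ p′ | inj₂ (inj₁ (refl , refl)) = inj₂ (m , p′ , σ)
  ... | inj₁ p′ | inj₂ (inj₂ (refl , refl)) = inj₂ (rev R-sym (m , p′ , σ))
  ... | inj₂ (inj₁ (l₁ , l₂ , s , t , τ)) | e′ =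
    inj₂ (glue u 3≤ (l₁ , l₂ , s , t , ↭-trans τ σ) e′)
  ... | inj₂ (inj₂ (l₁ , l₂ , s , t , τ)) | e′ =
    inj₂ (rev R-sym (glue u 3≤ (l₁ , l₂ , s , t , ↭-trans τ σ) (Sum.map₂ Sum.swap e′)))

-- Blue triangles in the absence of a blue C₄

module Absorption
  {V : Set} (_≟_ : DecidableEquality V) (B : Rel V 0ℓ) (B? : Decidable B)
  (B-sym : Symmetric B) (B-irrefl : Irreflexive _≡_ B)
  (noC₄ : ∀ {w x y z} → B w x → B x y → B y z → B z w → w ≢ y → x ≢ z → ⊥)
  where

  open CMSolver (++-commutativeMonoid {A = V}) using (solve; _⊜_; _⊕_)

  -- R also holds on the diagonal; it means red because vertex lists are duplicate-free.
  R : Rel V 0ℓ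
  R x y = ¬ B x y

  R-sym : Symmetric R
  R-sym r b = r (B-sym b)

  -- Blue triangles and the vertices around them

  record Triangle (a b c : V) : Set where
    constructor triangle
    field
      ab : B a b
      bc : B b c
      ca : B c a

  mirror : Triangle a b c → Triangle b a c
  mirror (triangle ab bc ca) = triangle (B-sym ab) (B-sym ca) (B-sym bc)

  rotate : Triangle a b c → Triangle b c a
  rotate (triangle ab bc ca) = triangle bc ca ab

  -- A common blue neighbour `z` of `a` and `b` other than `c` would give the blue four-cycle
  -- `a z b c`.
  only-one : Triangle a b c → z ≢ c → B a z → R b z
  only-one (triangle ab bc ca) z≢c az bz =
    noC₄ az (B-sym bz) bc ca (λ { refl → B-irrefl refl ab }) z≢c

  -- In each name `x⇒y` below, a blue edge at `x` forces the edge from `y` to the same vertex to be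
  -- red. These are the six instances of `only-one` off the triangle.
  module Labels {a b c : V} {W : List V}
    (tri : Triangle a b c) (uniq : Unique (a ∷ b ∷ c ∷ W)) where

    private
      apart : Unique (a ∷ b ∷ c ∷ W) → z ∈ W → (z ≢ a) × (z ≢ b) × (z ≢ c)
      apart ((_ ∷ _ ∷ f) ∷ (_ ∷ g) ∷ h ∷ _) z∈ =
        ≢-sym (All.lookup f z∈) , ≢-sym (All.lookup g z∈) , ≢-sym (All.lookup h z∈)

    ≢a : z ∈ W → z ≢ a
    ≢a = proj₁ ∘ apart uniq

    ≢b : z ∈ W → z ≢ b
    ≢b = proj₁ ∘ proj₂ ∘ apart uniq

    ≢c : z ∈ W → z ≢ c
    ≢c = proj₂ ∘ proj₂ ∘ apart uniq

    a⇒b : z ∈ W → B a z → R b z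
    a⇒b z∈ = only-one tri (≢c z∈)

    b⇒a : z ∈ W → B b z → R a z
    b⇒a z∈ = only-one (mirror tri) (≢c z∈)

    b⇒c : z ∈ W → B b z → R c z
    b⇒c z∈ = only-one (rotate tri) (≢a z∈)

    c⇒b : z ∈ W → B c z → R b z
    c⇒b z∈ = only-one (mirror (rotate tri)) (≢a z∈)

    c⇒a : z ∈ W → B c z → R a z
    c⇒a z∈ = only-one (rotate (rotate tri)) (≢b z∈)

    a⇒c : z ∈ W → B a z → R c z
    a⇒c z∈ = only-one (mirror (rotate (rotate tri))) (≢b z∈)

  -- The path b u … t a together with the recoloured edge ab, when c is not on it.
  record Outer (a b c u t : V) (W : List V) : Set where
    field
      tri  : Triangle a b c
      uniq : Unique (a ∷ b ∷ c ∷ W)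
      bu   : R b u
      seg  : Seg R u t W
      ta   : R t a

  mirrorOuter : Outer a b c u t W → Outer b a c t u W
  mirrorOuter o = record
    { tri  = mirror tri
    ; uniq = Unique-resp-↭ (swap _ _ ↭-refl) uniq
    ; bu   = R-sym ta
    ; seg  = rev R-sym seg
    ; ta   = R-sym bu
    }
    where open Outer o

  -- Each alternative keeps the length of the original cycle, since two triangle vertices remain.
  Replaced : V → V → V → List V → Set
  Replaced a b c W = Closed R (a ∷ b ∷ W) ⊎ Closed R (a ∷ c ∷ W) ⊎ Closed R (b ∷ c ∷ W)

  mirrorReplaced : Replaced b a c W → Replaced a b c W
  mirrorReplaced (inj₁ o)        = inj₁ (Closed-resp-↭ (swap _ _ ↭-refl) o)
  mirrorReplaced (inj₂ (inj₁ o)) = inj₂ (inj₂ o)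
  mirrorReplaced (inj₂ (inj₂ o)) = inj₂ (inj₁ o)

  -- Blue adjacency to `b` is followed from `y` towards `t`. Where it stops, a crossing closes the
  -- cycle. If it never stops, all these vertices are red to `a` and `c`, and `c` takes the place of
  -- `b`.
  replace-second : Outer a b c u t W →
    R u y → Seg R y t W₁ → [ u ] ++ W₁ ↭ W →
    R y z → Seg R z t W₂ → [ y ] ++ W₂ ↭ W₁ →
    B b y → Replaced a b c W
  replace-second {a} {b} {c} {u} {t} {W} {y} {W₁} {z} {W₂} o uy yt σ yz zt τ by
    with spread (B? b) yt by
  ... | inj₂ (exit {p} {q} {l₁} {l₂} before bp _ ¬bq after ρ) =
    inj₁ (Closed-resp-↭ perm
      (crossing R-sym (⟨ b ⟩ —⟨ bu ⟩— ⟨ u ⟩ —⟨ uy ⟩— before) (R-sym (b⇒a p∈ bp))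
        (after —⟨ ta ⟩— ⟨ a ⟩) (R-sym ¬bq)))
    where
    open Outer o
    open Labels tri uniq
    p∈ : p ∈ W
    p∈ = ∈-resp-↭ σ (there (∈-resp-↭ ρ (∈-++⁺ˡ (end∈ R-sym before))))
    perm : (b ∷ u ∷ l₁) ++ (l₂ ++ [ a ]) ↭ a ∷ b ∷ W
    perm = ↭-trans
      (solve 5 (λ a b u l₁ l₂ → (b ⊕ u ⊕ l₁) ⊕ (l₂ ⊕ a) ⊜ a ⊕ b ⊕ u ⊕ l₁ ⊕ l₂) ↭-refl
        [ a ] [ b ] [ u ] l₁ l₂)
      (prep a (prep b (↭-trans (prep u ρ) σ)))
  ... | inj₁ allB = inj₂ (inj₁ via-c)
    where
    open Outer o
    open Labels tri uniq
    W₁⊆W : x ∈ W₁ → x ∈ W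
    W₁⊆W x∈ = ∈-resp-↭ σ (there x∈)
    u∈ : u ∈ W
    u∈ = ∈-resp-↭ σ (here refl)
    z∈ : z ∈ W₁
    z∈ = ∈-resp-↭ τ (there (start∈ zt))
    az : R a z
    az = b⇒a (W₁⊆W z∈) (All.lookup allB z∈)
    tc : R t c
    tc = R-sym (b⇒c (W₁⊆W (end∈ R-sym yt)) (All.lookup allB (end∈ R-sym yt)))
    y∈ : y ∈ W
    y∈ = W₁⊆W (start∈ yt)
    σ′ : u ∷ y ∷ W₂ ↭ W
    σ′ = ↭-trans (prep u τ) σ
    via-c : Closed R (a ∷ c ∷ W)
    -- The vertex `a` is inserted before `z`. If `c u` is blue, then `u a` is red and `u` and `y`
    -- trade places.
    via-c with B? c u
    ... | no ¬cu = Closed-resp-↭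
      (↭-trans
        (solve 5 (λ a c u y l → c ⊕ u ⊕ y ⊕ a ⊕ l ⊜ a ⊕ c ⊕ u ⊕ y ⊕ l) ↭-refl
          [ a ] [ c ] [ u ] [ y ] W₂)
        (prep a (prep c σ′)))
      (_ , _ , ⟨ c ⟩ —⟨ ¬cu ⟩— ⟨ u ⟩ —⟨ uy ⟩— ⟨ y ⟩ —⟨ R-sym (b⇒a y∈ by) ⟩— ⟨ a ⟩ —⟨ az ⟩— zt , tc)
    ... | yes cu = Closed-resp-↭
      (↭-trans
        (solve 5 (λ a c u y l → c ⊕ y ⊕ u ⊕ a ⊕ l ⊜ a ⊕ c ⊕ u ⊕ y ⊕ l) ↭-refl
          [ a ] [ c ] [ u ] [ y ] W₂)
        (prep a (prep c σ′)))
      (_ , _ , ⟨ c ⟩ —⟨ b⇒c y∈ by ⟩— ⟨ y ⟩ —⟨ R-sym uy ⟩— ⟨ u ⟩ —⟨ R-sym (c⇒a u∈ cu) ⟩—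
        ⟨ a ⟩ —⟨ az ⟩— zt , tc)

  uncons₂ : 3 ≤ length W → Seg R u t W →
    ∃₂ λ y W₁ → ∃₂ λ z W₂ →
      R u y × Seg R y t W₁ × [ u ] ++ W₁ ↭ W × R y z × Seg R z t W₂ × [ y ] ++ W₂ ↭ W₁
  uncons₂ 3≤ p with uncons p
  ... | inj₁ (_ , σ) with s≤s () ← subst (3 ≤_) (sym (↭-length σ)) 3≤
  ... | inj₂ (_ , _ , uy , q , σ) with uncons q
  ... | inj₂ (_ , _ , yz , r , τ) = _ , _ , _ , _ , uy , q , σ , yz , r , τ
  ... | inj₁ (_ , τ)
    with s≤s (s≤s ()) ← subst (3 ≤_) (sym (↭-length (↭-trans (prep _ τ) σ))) 3≤

  cross-first : Outer a b c u t W → R u y → Seg R y t W₁ → [ u ] ++ W₁ ↭ W →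
    R a u → R b y → Closed R (a ∷ b ∷ W)
  cross-first {a} {b} {u = u} {W₁ = W₁} o uy yt σ au by = Closed-resp-↭
    (↭-trans
      (solve 4 (λ a b u l → (b ⊕ u) ⊕ l ⊕ a ⊜ a ⊕ b ⊕ u ⊕ l) ↭-refl [ a ] [ b ] [ u ] W₁)
      (prep a (prep b σ)))
    (crossing R-sym (⟨ b ⟩ —⟨ bu ⟩— ⟨ u ⟩) (R-sym au) (yt —⟨ ta ⟩— ⟨ a ⟩) (R-sym by))
    where open Outer o

  -- If `b y` or `a x` is blue, `replace-second` applies at that end. If both are red, a crossing at
  -- the first or last edge of `W` works unless `a u` and `b t` are blue; then `c` replaces `a` in
  -- the cycle `c u b y … t`.
  absorb-outer : Outer a b c u t W → 3 ≤ length W → Replaced a b c W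
  absorb-outer {a} {b} {c} {u} {t} {W} o 3≤
    with uncons₂ 3≤ (Outer.seg o) | uncons₂ 3≤ (Outer.seg (mirrorOuter o))
  ... | y , W₁ , _ , _ , uy , yt , σ , yz , zt , τ | x , _ , _ , _ , tx , xu , σ′ , xw , wu , τ′
    with B? b y | B? a x
  ... | yes by | _ = replace-second o uy yt σ yz zt τ by
  ... | no _ | yes ax =
    mirrorReplaced (replace-second (mirrorOuter o) tx xu σ′ xw wu τ′ ax)
  ... | no ¬by | no ¬ax with B? a u | B? b t
  ... | no ¬au | _ = inj₁ (cross-first o uy yt σ ¬au ¬by)
  ... | yes _ | no ¬bt =
    mirrorReplaced (inj₁ (cross-first (mirrorOuter o) tx xu σ′ ¬bt ¬ax))
  ... | yes au | yes bt = inj₂ (inj₂ (Closed-resp-↭ perm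
      (_ , _ , ⟨ c ⟩ —⟨ a⇒c (start∈ seg) au ⟩— ⟨ u ⟩ —⟨ R-sym bu ⟩— ⟨ b ⟩ —⟨ ¬by ⟩— yt
      , R-sym (b⇒c (end∈ R-sym seg) bt))))
    where
    open Outer o
    open Labels tri uniq
    perm : c ∷ u ∷ b ∷ W₁ ↭ b ∷ c ∷ W
    perm = ↭-trans
      (solve 4 (λ b c u l → c ⊕ u ⊕ b ⊕ l ⊜ b ⊕ c ⊕ u ⊕ l) ↭-refl [ b ] [ c ] [ u ] W₁)
      (prep b (prep c σ))

  -- The path b P c Q a together with the recoloured edge ab, where P runs from u
  -- to v and Q from s to t.
  record Through (a b c u v s t : V) (P Q : List V) : Set where
    field
      tri  : Triangle a b c
      uniq : Unique (a ∷ b ∷ c ∷ P ++ Q)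
      bu   : R b u
      uv   : Seg R u v P
      vc   : R v c
      cs   : R c s
      st   : Seg R s t Q
      ta   : R t a

    open Labels tri uniq public

    P⊆ : x ∈ P → x ∈ P ++ Q
    P⊆ = ∈-++⁺ˡ

    Q⊆ : x ∈ Q → x ∈ P ++ Q
    Q⊆ = ∈-++⁺ʳ P

  mirrored-↭ : ∀ b a c (Q P : List V) → b ∷ a ∷ c ∷ Q ++ P ↭ a ∷ b ∷ c ∷ P ++ Q
  mirrored-↭ b a c Q P = swap b a (prep c (++-comm Q P))

  mirrorThrough : Through a b c u v s t P Q → Through b a c t s v u Q P
  mirrorThrough {P = P} {Q = Q} o = record
    { tri  = mirror tri
    ; uniq = Unique-resp-↭ (mirrored-↭ _ _ _ P Q) uniq
    ; bu   = R-sym ta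
    ; uv   = rev R-sym st
    ; vc   = R-sym cs
    ; cs   = R-sym vc
    ; st   = rev R-sym uv
    ; ta   = R-sym bu
    }
    where open Through o

  -- The colour of the edge from `a` to `e` is left open. The two red segments are kept because the
  -- final cycle is assembled from them.
  record Bad (a b c : V) (L : List V) : Set where
    field
      {e p q p′ q′} : V
      {l₁ l₂}       : List V
      pq            : Seg R p q l₁
      p′q′          : Seg R p′ q′ l₂
      blue₁         : All (B a) l₁
      blue₂         : All (B a) l₂
      perm          : a ∷ b ∷ c ∷ e ∷ l₁ ++ l₂ ↭ L

  Outcome : V → V → V → List V → Set
  Outcome a b c L = Closed R L ⊎ Bad a b c L ⊎ Bad b a c L

  Bad-resp-↭ : l ↭ m → Bad a b c l → Bad a b c m
  Bad-resp-↭ σ β = record { Bad β ; perm = ↭-trans (Bad.perm β) σ }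

  Outcome-resp-↭ : l ↭ m → Outcome a b c l → Outcome a b c m
  Outcome-resp-↭ σ = Sum.map (Closed-resp-↭ σ) (Sum.map (Bad-resp-↭ σ) (Bad-resp-↭ σ))

  mirrorOutcome : l ↭ m → Outcome b a c l → Outcome a b c m
  mirrorOutcome σ = Sum.map₂ Sum.swap ∘ Outcome-resp-↭ σ

  Total : (a b c : V) (P Q : List V) → Set
  Total a b c P Q = Closed R (a ∷ b ∷ c ∷ P ++ Q)

  mirrorTotal : ∀ P → Total b a c Q P → Total a b c P Q
  mirrorTotal P = Closed-resp-↭ (mirrored-↭ _ _ _ _ P)

  -- A vertex of `Q` blue to `b` is red to `a`, so the first change from blue to red at `b` supplies
  -- both chords of a crossing.
  spread-from-c : Through a b c u v s t P Q → B b s → All (B b) Q ⊎ Total a b c P Q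
  spread-from-c {a} {b} {c} {P = P} {Q} o bs with spread (B? b) (Through.st o) bs
  ... | inj₁ allB = inj₁ allB
  ... | inj₂ (exit {p} {q} {l₁} {l₂} before bp _ ¬bq after ρ) = inj₂ (Closed-resp-↭ perm
      (crossing R-sym (⟨ b ⟩ —⟨ bu ⟩— uv —⟨ vc ⟩— ⟨ c ⟩ —⟨ cs ⟩— before) (R-sym (b⇒a p∈ bp))
        (after —⟨ ta ⟩— ⟨ a ⟩) (R-sym ¬bq)))
    where
    open Through o
    p∈ : p ∈ P ++ Q
    p∈ = Q⊆ (∈-resp-↭ ρ (∈-++⁺ˡ (end∈ R-sym before)))
    perm : (b ∷ P ++ c ∷ l₁) ++ (l₂ ++ [ a ]) ↭ a ∷ b ∷ c ∷ P ++ Q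
    perm = ↭-trans
      (solve 6 (λ a b c p l₁ l₂ → (b ⊕ p ⊕ c ⊕ l₁) ⊕ l₂ ⊕ a ⊜ a ⊕ b ⊕ c ⊕ p ⊕ l₁ ⊕ l₂)
        ↭-refl [ a ] [ b ] [ c ] P l₁ l₂)
      (++⁺ˡ (a ∷ b ∷ c ∷ P) ρ)

  -- The same crossing found backwards from `x`, with `a` in the role of `b`; it starts before `t`
  -- because `t a` is red.
  spread-to-c : Through a b c u v s t P Q → Seg R s x Q₁ → R x t → Q₁ ++ [ t ] ↭ Q →
    B a x → All (B a) Q₁ ⊎ Total a b c P Q
  spread-to-c {a} {b} {c} {t = t} {P = P} {Q} {x} {Q₁} o sx xt σ ax
    with spread (B? a) (rev R-sym sx) ax
  ... | inj₁ allA = inj₁ allA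
  ... | inj₂ (exit {p} {q} {l₁} {l₂} before ap _ ¬aq after ρ) = inj₂ (Closed-resp-↭ perm
      (crossing R-sym
        (⟨ b ⟩ —⟨ bu ⟩— uv —⟨ vc ⟩— ⟨ c ⟩ —⟨ cs ⟩— rev R-sym after) (R-sym ¬aq)
        (rev R-sym before —⟨ xt ⟩— ⟨ t ⟩ —⟨ ta ⟩— ⟨ a ⟩) (R-sym (a⇒b p∈ ap))))
    where
    open Through o
    p∈ : p ∈ P ++ Q
    p∈ = Q⊆ (∈-resp-↭ σ (∈-++⁺ˡ (∈-resp-↭ ρ (∈-++⁺ˡ (end∈ R-sym before)))))
    perm : (b ∷ P ++ c ∷ l₂) ++ (l₁ ++ t ∷ [ a ]) ↭ a ∷ b ∷ c ∷ P ++ Q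
    perm = ↭-trans
      (solve 7 (λ a b c t p l₁ l₂ →
          (b ⊕ p ⊕ c ⊕ l₂) ⊕ l₁ ⊕ t ⊕ a ⊜ a ⊕ b ⊕ c ⊕ p ⊕ (l₁ ⊕ l₂) ⊕ t)
        ↭-refl [ a ] [ b ] [ c ] [ t ] P l₁ l₂)
      (++⁺ˡ (a ∷ b ∷ c ∷ P) (↭-trans (++⁺ʳ [ t ] ρ) σ))

  -- If `c t` is blue, then `b t` is red and the edge `x t` can be crossed. If `c t` is red, the
  -- cycle is `t c v … u b s … x a`.
  close-last : Through a b c u v s t P Q → Seg R s x Q₁ → R x t → Q₁ ++ [ t ] ↭ Q →
    R b s → R a x → Total a b c P Q
  close-last {a} {b} {c} {t = t} {P = P} {Q} {x} {Q₁} o sx xt σ bs ax with B? c t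
  ... | yes ct = Closed-resp-↭ (↭-trans perm (++⁺ˡ (a ∷ b ∷ c ∷ P) σ))
      (crossing R-sym (⟨ b ⟩ —⟨ bu ⟩— uv —⟨ vc ⟩— ⟨ c ⟩ —⟨ cs ⟩— sx) (R-sym ax)
        (⟨ t ⟩ —⟨ ta ⟩— ⟨ a ⟩) (R-sym (c⇒b (Q⊆ (end∈ R-sym st)) ct)))
    where
    open Through o
    perm : (b ∷ P ++ c ∷ Q₁) ++ (t ∷ [ a ]) ↭ a ∷ b ∷ c ∷ P ++ Q₁ ++ [ t ]
    perm = solve 6 (λ a b c t p q → (b ⊕ p ⊕ c ⊕ q) ⊕ t ⊕ a ⊜ a ⊕ b ⊕ c ⊕ p ⊕ q ⊕ t)
      ↭-refl [ a ] [ b ] [ c ] [ t ] P Q₁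
  ... | no ¬ct = Closed-resp-↭ (↭-trans perm (++⁺ˡ (a ∷ b ∷ c ∷ P) σ))
      (_ , _ , ⟨ t ⟩ —⟨ R-sym ¬ct ⟩— ⟨ c ⟩ —⟨ R-sym vc ⟩— rev R-sym uv —⟨ R-sym bu ⟩—
        ⟨ b ⟩ —⟨ bs ⟩— sx —⟨ R-sym ax ⟩— ⟨ a ⟩ , R-sym ta)
    where
    open Through o
    perm : t ∷ c ∷ P ++ b ∷ Q₁ ++ [ a ] ↭ a ∷ b ∷ c ∷ P ++ Q₁ ++ [ t ]
    perm = solve 6 (λ a b c t p q → t ⊕ c ⊕ p ⊕ b ⊕ q ⊕ a ⊜ a ⊕ b ⊕ c ⊕ p ⊕ q ⊕ t)
      ↭-refl [ a ] [ b ] [ c ] [ t ] P Q₁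

  -- All of `Q` is red to `a` and `c`, so only the link from `v` to `Q` is in doubt. As `b s v t` is
  -- not a blue four-cycle, `v` is red to `s` or to `t`, and either one closes a cycle.
  close-matched : Through a b c u v s t P Q → Seg R s x Q₁ → R x t → Q₁ ++ [ t ] ↭ Q →
    R u y → Seg R y v P₁ → [ u ] ++ P₁ ↭ P → R b y →
    All (B a) P → All (B b) Q → Total a b c P Q
  close-matched {a} {b} {c} {u} {v} {s} {t} {P} {Q} {x} {Q₁} {y} {P₁} o sx xt σ uy yv τ by aP bQ =
    choose
    where
    open Through o
    s∈ : s ∈ Q
    s∈ = start∈ st
    t∈ : t ∈ Q
    t∈ = end∈ R-sym st
    x∈ : x ∈ Q
    x∈ = ∈-resp-↭ σ (∈-++⁺ˡ (end∈ R-sym sx))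
    av : B a v
    av = All.lookup aP (end∈ R-sym uv)
    cu : R c u
    cu = a⇒c (P⊆ (start∈ uv)) (All.lookup aP (start∈ uv))
    a-Q : z ∈ Q → R a z
    a-Q z∈ = b⇒a (Q⊆ z∈) (All.lookup bQ z∈)
    c-Q : z ∈ Q → R c z
    c-Q z∈ = b⇒c (Q⊆ z∈) (All.lookup bQ z∈)
    s≢t : s ≢ t
    s≢t with uniq
    ... | _ ∷ _ ∷ _ ∷ f =
      Unique-++-apart (P ++ Q₁)
        (Unique-resp-↭ (↭-trans (++⁺ˡ P (↭-sym σ)) (↭-sym (++-assoc P Q₁ [ t ]))) f)
        (∈-++⁺ʳ P (start∈ sx)) (here refl)
    perm : ∀ {l} → l ↭ a ∷ b ∷ c ∷ (u ∷ P₁) ++ (Q₁ ++ [ t ]) → l ↭ a ∷ b ∷ c ∷ P ++ Q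
    perm ρ = ↭-trans ρ (++⁺ˡ (a ∷ b ∷ c ∷ []) (++-cong τ σ))
    choose : Total a b c P Q
    choose with B? v s
    ... | no ¬vs = Closed-resp-↭
      (perm (solve 7 (λ a b c u t p q → u ⊕ b ⊕ p ⊕ q ⊕ a ⊕ t ⊕ c ⊜ a ⊕ b ⊕ c ⊕ (u ⊕ p) ⊕ q ⊕ t)
        ↭-refl [ a ] [ b ] [ c ] [ u ] [ t ] P₁ Q₁))
      (_ , _ , ⟨ u ⟩ —⟨ R-sym bu ⟩— ⟨ b ⟩ —⟨ by ⟩— yv —⟨ ¬vs ⟩— sx —⟨ R-sym (a-Q x∈) ⟩—
        ⟨ a ⟩ —⟨ R-sym ta ⟩— ⟨ t ⟩ —⟨ R-sym (c-Q t∈) ⟩— ⟨ c ⟩ , cu)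
    ... | yes vs = Closed-resp-↭
      (perm (solve 7 (λ a b c u t p q → u ⊕ b ⊕ p ⊕ t ⊕ a ⊕ q ⊕ c ⊜ a ⊕ b ⊕ c ⊕ (u ⊕ p) ⊕ q ⊕ t)
        ↭-refl [ a ] [ b ] [ c ] [ u ] [ t ] P₁ Q₁))
      (_ , _ , ⟨ u ⟩ —⟨ R-sym bu ⟩— ⟨ b ⟩ —⟨ by ⟩— yv —⟨ ¬vt ⟩— ⟨ t ⟩ —⟨ ta ⟩—
        ⟨ a ⟩ —⟨ a-Q s∈ ⟩— sx —⟨ R-sym (c-Q x∈) ⟩— ⟨ c ⟩ , cu)
      where
      ¬vt : R v t
      ¬vt vt = noC₄ (All.lookup bQ s∈) (B-sym vs) vt (B-sym (All.lookup bQ t∈))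
        (λ { refl → ≢b (P⊆ (end∈ R-sym uv)) refl }) s≢t

  -- If `c t` is red, `t a v … u b x … s c` is a cycle. Otherwise `b t` is red, and
  -- `t a u … v c s … x b` serves if `a u` is red. If `a u` is blue, then `c u` is red and `u ≢ v`,
  -- and the colour of `b y` decides.
  close-diverging : Through a b c u v s t P Q → Seg R s x Q₁ → R x t → Q₁ ++ [ t ] ↭ Q →
    R b s → B a x → R a v → Total a b c P Q
  close-diverging {a} {b} {c} {u} {v} {s} {t} {P} {Q} {x} {Q₁} o sx xt σ bs ax av = choose
    where
    open Through o
    u∈ : u ∈ P ++ Q
    u∈ = P⊆ (start∈ uv)
    bx : R b x
    bx = a⇒b (Q⊆ (∈-resp-↭ σ (∈-++⁺ˡ (end∈ R-sym sx)))) ax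
    perm : ∀ {l} → l ↭ a ∷ b ∷ c ∷ P ++ (Q₁ ++ [ t ]) → l ↭ a ∷ b ∷ c ∷ P ++ Q
    perm ρ = ↭-trans ρ (++⁺ˡ (a ∷ b ∷ c ∷ P) σ)
    choose : Total a b c P Q
    choose with B? c t | B? a u
    ... | no ¬ct | _ = Closed-resp-↭
      (perm (solve 6 (λ a b c t p q → t ⊕ a ⊕ p ⊕ b ⊕ q ⊕ c ⊜ a ⊕ b ⊕ c ⊕ p ⊕ q ⊕ t)
        ↭-refl [ a ] [ b ] [ c ] [ t ] P Q₁))
      (_ , _ , ⟨ t ⟩ —⟨ ta ⟩— ⟨ a ⟩ —⟨ av ⟩— rev R-sym uv —⟨ R-sym bu ⟩— ⟨ b ⟩ —⟨ bx ⟩—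
        rev R-sym sx —⟨ R-sym cs ⟩— ⟨ c ⟩ , ¬ct)
    ... | yes ct | no ¬au = Closed-resp-↭
      (perm (solve 6 (λ a b c t p q → t ⊕ a ⊕ p ⊕ c ⊕ q ⊕ b ⊜ a ⊕ b ⊕ c ⊕ p ⊕ q ⊕ t)
        ↭-refl [ a ] [ b ] [ c ] [ t ] P Q₁))
      (_ , _ , ⟨ t ⟩ —⟨ ta ⟩— ⟨ a ⟩ —⟨ ¬au ⟩— uv —⟨ vc ⟩— ⟨ c ⟩ —⟨ cs ⟩— sx —⟨ R-sym bx ⟩— ⟨ b ⟩
      , c⇒b (Q⊆ (end∈ R-sym st)) ct)
    ... | yes ct | yes au with uncons uv
    ... | inj₁ (refl , _) = contradiction au av
    ... | inj₂ (y , P₁ , uy , yv , τ) with B? b y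
    ... | no ¬by = mirrorTotal P (close-last (mirrorThrough o)
            (rev R-sym yv) (R-sym uy) (↭-trans (++-comm P₁ [ u ]) τ) av ¬by)
    ... | yes by = Closed-resp-↭
      (↭-trans
        (solve 6 (λ a b c u p q → u ⊕ b ⊕ q ⊕ a ⊕ p ⊕ c ⊜ a ⊕ b ⊕ c ⊕ (u ⊕ p) ⊕ q)
          ↭-refl [ a ] [ b ] [ c ] [ u ] P₁ Q)
        (++⁺ˡ (a ∷ b ∷ c ∷ []) (++⁺ʳ Q τ)))
      (_ , _ , ⟨ u ⟩ —⟨ R-sym bu ⟩— ⟨ b ⟩ —⟨ bs ⟩— st —⟨ ta ⟩— ⟨ a ⟩ —⟨ ay ⟩— yv —⟨ vc ⟩— ⟨ c ⟩
      , a⇒c u∈ au)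
      where
      ay : R a y
      ay = b⇒a (P⊆ (∈-resp-↭ τ (there (start∈ yv)))) by

  -- The colours at the ends of `P` and `Q` decide. When no cycle closes, either `a` is bad with
  -- exceptional vertex `t`, or `b` is bad with exceptional vertex `u`.
  absorb-long : Through a b c u v s t P Q → Seg R s x Q₁ → R x t → Q₁ ++ [ t ] ↭ Q →
    Outcome a b c (a ∷ b ∷ c ∷ P ++ Q)
  absorb-long {a} {b} {c} {u} {v} {s} {t} {P} {Q} {x} {Q₁} o sx xt σ with B? b s
  ... | no ¬bs = from-x
    where
    open Through o
    from-x : Outcome a b c (a ∷ b ∷ c ∷ P ++ Q)
    from-x with B? a x | B? a v
    ... | no ¬ax | _      = inj₁ (close-last o sx xt σ ¬bs ¬ax)
    ... | yes ax | no ¬av = inj₁ (close-diverging o sx xt σ ¬bs ax ¬av)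
    ... | yes ax | yes av
      with spread-to-c o sx xt σ ax | spread-from-c (mirrorThrough o) av
    ... | inj₂ o₁ | _       = inj₁ o₁
    ... | inj₁ _  | inj₂ o₂ = inj₁ (mirrorTotal P o₂)
    ... | inj₁ aQ | inj₁ aP = inj₂ (inj₁ (record
      { pq = uv ; p′q′ = sx ; blue₁ = aP ; blue₂ = aQ
      ; perm = ↭-trans
          (solve 6 (λ a b c t p q → a ⊕ b ⊕ c ⊕ t ⊕ p ⊕ q ⊜ a ⊕ b ⊕ c ⊕ p ⊕ q ⊕ t)
            ↭-refl [ a ] [ b ] [ c ] [ t ] P Q₁)
          (++⁺ˡ (a ∷ b ∷ c ∷ P) σ)
      }))
  ... | yes bs with spread-from-c o bs
  ... | inj₂ o₁ = inj₁ o₁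
  ... | inj₁ bQ = from-P
    where
    open Through o
    from-P : Outcome a b c (a ∷ b ∷ c ∷ P ++ Q)
    from-P with uncons uv
    -- Here `P` is just `u`, so both segments come from `Q`, cut before its last vertex.
    ... | inj₁ (_ , τ) = inj₂ (inj₂ (record
      { pq = sx ; p′q′ = ⟨ t ⟩ ; blue₁ = ++⁻ˡ Q₁ bQ₁t ; blue₂ = ++⁻ʳ Q₁ bQ₁t
      ; perm = swap b a (prep c (++-cong τ σ))
      }))
      where
      bQ₁t : All (B b) (Q₁ ++ [ t ])
      bQ₁t = All-resp-↭ (↭-sym σ) bQ
    ... | inj₂ (y , P₁ , uy , yv , τ) = from-y
      where
      τ′ : P₁ ++ [ u ] ↭ P
      τ′ = ↭-trans (++-comm P₁ [ u ]) τ
      from-y : Outcome a b c (a ∷ b ∷ c ∷ P ++ Q)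
      from-y with B? b y
      ... | yes by with spread-to-c (mirrorThrough o) (rev R-sym yv) (R-sym uy) τ′ by
      ...   | inj₂ o₁ = inj₁ (mirrorTotal P o₁)
      ...   | inj₁ bP = inj₂ (inj₂ (record
        { pq = yv ; p′q′ = st ; blue₁ = bP ; blue₂ = bQ
        ; perm = swap b a (prep c (++⁺ʳ Q τ))
        }))
      from-y | no ¬by with B? a v
      ...   | no ¬av = inj₁ (mirrorTotal P
        (close-last (mirrorThrough o) (rev R-sym yv) (R-sym uy) τ′ ¬av ¬by))
      ...   | yes av with spread-from-c (mirrorThrough o) av
      ...     | inj₂ o₁ = inj₁ (mirrorTotal P o₁)
      ...     | inj₁ aP = inj₁ (close-matched o sx xt σ uy yv τ ¬by aP bQ)

  -- Three vertices on `P` and `Q` together put two on one of them; reflection makes that one `Q`.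
  absorb-through : Through a b c u v s t P Q → 3 ≤ length (P ++ Q) →
    Outcome a b c (a ∷ b ∷ c ∷ P ++ Q)
  absorb-through {c = c} {P = P} {Q = Q} o 3≤
    with unsnoc R-sym (Through.st o) | uncons (Through.uv o)
  ... | inj₂ (_ , _ , sx , xt , σ) | _ = absorb-long o sx xt σ
  ... | inj₁ _ | inj₂ (_ , P₁ , uy , yv , τ) = mirrorOutcome (mirrored-↭ _ _ c Q P)
    (absorb-long (mirrorThrough o) (rev R-sym yv) (R-sym uy) (↭-trans (++-comm P₁ _) τ))
  ... | inj₁ (_ , σ) | inj₁ (_ , τ)
    with s≤s (s≤s ()) ← subst (3 ≤_) (sym (↭-length (++-cong τ σ))) 3≤

  -- Two blue neighbours `r₁`, `r₂` of `b` replace `c` and `e` in `l`, so the length of `l` is kept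
  -- whatever the length of `m`. Both are red to `a`, and both segments of `l` are red to `b`.
  closed-of-two-bad : Triangle a b c → Unique l → Bad a b c l → Unique m → Bad b a c m →
    ∃[ k ] Unique k × length k ≡ length l × Closed R k
  closed-of-two-bad {a} {b} {c} {l} {m} tri uₗ α uₘ β
    with Unique-resp-↭ (↭-sym (Bad.perm α)) uₗ | Unique-resp-↭ (↭-sym (Bad.perm β)) uₘ
  ... | uα@((a≢b ∷ _ ∷ _ ∷ a∉) ∷ (_ ∷ _ ∷ b∉) ∷ _ ∷ _ ∷ uniq₁₂)
      | uβ@(_ ∷ _ ∷ _ ∷ _ ∷ uniqβ) = choose
    where
    open Bad α
    module β = Bad β
    module Lα = Labels tri uα
    module Lβ = Labels (mirror tri) uβ
    r₁ r₂ : V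
    r₁ = β.p
    r₂ = β.p′
    r₁∈ : r₁ ∈ β.l₁ ++ β.l₂
    r₁∈ = ∈-++⁺ˡ (start∈ β.pq)
    r₂∈ : r₂ ∈ β.l₁ ++ β.l₂
    r₂∈ = ∈-++⁺ʳ β.l₁ (start∈ β.p′q′)
    r₁≢r₂ : r₁ ≢ r₂
    r₁≢r₂ = Unique-++-apart β.l₁ uniqβ (start∈ β.pq) (start∈ β.p′q′)
    q≢p′ : q ≢ p′
    q≢p′ = Unique-++-apart l₁ uniq₁₂ (end∈ R-sym pq) (start∈ p′q′)
    allBlue : All (B a) (l₁ ++ l₂)
    allBlue = ++⁺ blue₁ blue₂
    allBlueβ : All (B b) (β.l₁ ++ β.l₂)
    allBlueβ = ++⁺ β.blue₁ β.blue₂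
    b-l : z ∈ l₁ ++ l₂ → R b z
    b-l z∈ = Lα.a⇒b (there z∈) (All.lookup allBlue z∈)
    a-β : z ∈ β.l₁ ++ β.l₂ → R a z
    a-β z∈ = Lβ.a⇒b (there z∈) (All.lookup allBlueβ z∈)
    -- A vertex red to `a` cannot lie on the segments, which are blue to `a`.
    fresh : z ∈ β.l₁ ++ β.l₂ → All (z ≢_) (l₁ ++ l₂)
    fresh z∈ = All.map (λ { ay refl → a-β z∈ ay }) allBlue
    link : ∀ {r s} → r ∈ β.l₁ ++ β.l₂ → s ∈ β.l₁ ++ β.l₂ → r ≢ s → R q r → R s p′ →
      ∃[ k ] Unique k × length k ≡ length l × Closed R k
    link {r} {s} r∈ s∈ r≢s qr sp′ = b ∷ a ∷ r ∷ s ∷ l₁ ++ l₂ ,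
      (≢-sym a≢b ∷ ≢-sym (Lβ.≢a (there r∈)) ∷ ≢-sym (Lβ.≢a (there s∈)) ∷ b∉) ∷
      (≢-sym (Lβ.≢b (there r∈)) ∷ ≢-sym (Lβ.≢b (there s∈)) ∷ a∉) ∷
      (r≢s ∷ fresh r∈) ∷ fresh s∈ ∷ uniq₁₂ ,
      ↭-length perm ,
      Closed-resp-↭
        (solve 6 (λ a b r s p q → b ⊕ p ⊕ r ⊕ a ⊕ s ⊕ q ⊜ b ⊕ a ⊕ r ⊕ s ⊕ p ⊕ q)
          ↭-refl [ a ] [ b ] [ r ] [ s ] l₁ l₂)
        (_ , _ , ⟨ b ⟩ —⟨ b-l (∈-++⁺ˡ (start∈ pq)) ⟩— pq —⟨ qr ⟩— ⟨ r ⟩ —⟨ R-sym (a-β r∈) ⟩—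
          ⟨ a ⟩ —⟨ a-β s∈ ⟩— ⟨ s ⟩ —⟨ sp′ ⟩— p′q′
        , R-sym (b-l (∈-++⁺ʳ l₁ (end∈ R-sym p′q′))))
    aq : B a q
    aq = All.lookup blue₁ (end∈ R-sym pq)
    ap′ : B a p′
    ap′ = All.lookup blue₂ (start∈ p′q′)
    br₁ : B b r₁
    br₁ = All.lookup allBlueβ r₁∈
    br₂ : B b r₂
    br₂ = All.lookup allBlueβ r₂∈
    q≢b : q ≢ b
    q≢b = Lα.≢b (there (∈-++⁺ˡ (end∈ R-sym pq)))
    p′≢b : p′ ≢ b
    p′≢b = Lα.≢b (there (∈-++⁺ʳ l₁ (start∈ p′q′)))
    r₁≢a : r₁ ≢ a
    r₁≢a = Lβ.≢b (there r₁∈)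
    r₂≢a : r₂ ≢ a
    r₂≢a = Lβ.≢b (there r₂∈)
    choose : ∃[ k ] Unique k × length k ≡ length l × Closed R k
    choose with B? q r₁ | B? r₂ p′
    ... | no ¬qr₁ | no ¬r₂p′ = link r₁∈ r₂∈ r₁≢r₂ ¬qr₁ ¬r₂p′
    -- Once one of `q r₁`, `r₂ p′` is blue, a blue `q r₂` or `r₁ p′` would complete a blue
    -- four-cycle through `a` or `b`; hence the exchanged order works.
    ... | yes qr₁ | _ = link r₂∈ r₁∈ (≢-sym r₁≢r₂)
      (λ qr₂ → noC₄ qr₁ (B-sym br₁) br₂ (B-sym qr₂) q≢b r₁≢r₂)
      (λ r₁p′ → noC₄ qr₁ r₁p′ (B-sym ap′) aq q≢p′ r₁≢a)
    ... | no _ | yes r₂p′ = link r₂∈ r₁∈ (≢-sym r₁≢r₂)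
      (λ qr₂ → noC₄ qr₂ r₂p′ (B-sym ap′) aq q≢p′ r₂≢a)
      (λ r₁p′ → noC₄ r₁p′ (B-sym r₂p′) (B-sym br₂) br₁ r₁≢r₂ p′≢b)

  -- From a recoloured edge to the whole triangle

  Equivalent : (List V → Set) → List V → Set
  Equivalent F l = ∃[ m ] Unique m × length m ≡ length l × F m

  replaced⇒equivalent : b ∷ W ++ [ a ] ↭ l → Unique (a ∷ b ∷ c ∷ W) → Replaced a b c W →
    Equivalent (Closed R) l
  replaced⇒equivalent {b} {W} {a} {l} {c} σ ((a≢b ∷ a≢c ∷ a∉) ∷ (b≢c ∷ b∉) ∷ c∉ ∷ u) = pick
    where
    len : suc (suc (length W)) ≡ length l
    len = ↭-length (↭-trans (swap a b (↭-refl {x = W})) (↭-trans (prep b (∷↭∷ʳ a W)) σ))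
    pick : Replaced a b c W → Equivalent (Closed R) l
    pick (inj₁ o)        = _ , (a≢b ∷ a∉) ∷ b∉ ∷ u , len , o
    pick (inj₂ (inj₁ o)) = _ , (a≢c ∷ a∉) ∷ c∉ ∷ u , len , o
    pick (inj₂ (inj₂ o)) = _ , (b≢c ∷ b∉) ∷ c∉ ∷ u , len , o

  absorb-off : Triangle a b c → Unique l → 6 ≤ length l → Seg R b a l → All (_≢ c) l →
    Equivalent (Closed R) l
  absorb-off (triangle ab _ _) uniq 6≤ ba c∉ with uncons ba
  ... | inj₁ (refl , _) = contradiction ab (B-irrefl refl)
  ... | inj₂ (_ , _ , bu , ua , σ) with unsnoc R-sym ua
  ... | inj₁ (refl , _) = contradiction (B-sym ab) bu
  absorb-off {a} {b} {c} {l} tri uniq 6≤ ba c∉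
      | inj₂ (u , _ , bu , ua , σ) | inj₂ (t , W , ut , ta , τ) =
    replaced⇒equivalent σ′ uniq′ (absorb-outer
      (record { tri = tri ; uniq = uniq′ ; bu = bu ; seg = ut ; ta = ta }) 3≤)
    where
    σ′ : b ∷ W ++ [ a ] ↭ l
    σ′ = ↭-trans (prep b τ) σ
    c∷l : c ∷ l ↭ a ∷ b ∷ c ∷ W
    c∷l = ↭-trans (prep c (↭-sym σ′))
      (solve 4 (λ a b c w → c ⊕ b ⊕ w ⊕ a ⊜ a ⊕ b ⊕ c ⊕ w) ↭-refl [ a ] [ b ] [ c ] W)
    uniq′ : Unique (a ∷ b ∷ c ∷ W)
    uniq′ = Unique-resp-↭ c∷l (All.map ≢-sym c∉ ∷ uniq)
    3≤ : 3 ≤ length W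
    -- The 7 counts `c` together with at least six vertices of the cycle.
    3≤ with s≤s (s≤s (s≤s 4≤)) ← subst (7 ≤_) (↭-length c∷l) (s≤s 6≤) = ≤-trans (n≤1+n 3) 4≤

  absorb-on : Triangle a b c → Unique l → 6 ≤ length l →
    Seg R b x P → R x c → Seg R c a Q → P ++ Q ↭ l → Outcome a b c l
  absorb-on (triangle ab bc ca) uniq 6≤ bx xc ca′ ρ with uncons bx
  ... | inj₁ (refl , _) = contradiction bc xc
  ... | inj₂ (_ , _ , bu , uv , σ) with uncons ca′
  ... | inj₁ (refl , _) = contradiction ca (B-irrefl refl)
  ... | inj₂ (_ , _ , cs , sa , τ) with unsnoc R-sym sa
  ... | inj₁ (refl , _) = contradiction ca cs
  absorb-on {a} {b} {c} {l} tri uniq 6≤ bx xc ca′ ρ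
      | inj₂ (u , P , bu , uv , σ) | inj₂ (s , _ , cs , sa , τ) | inj₂ (t , Q , st , ta , υ) =
    Outcome-resp-↭ perm (absorb-through
      (record
        { tri = tri ; uniq = Unique-resp-↭ (↭-sym perm) uniq
        ; bu = bu ; uv = uv ; vc = xc ; cs = cs ; st = st ; ta = ta
        })
      3≤)
    where
    perm : a ∷ b ∷ c ∷ P ++ Q ↭ l
    perm = ↭-trans
      (solve 5 (λ a b c p q → a ⊕ b ⊕ c ⊕ p ⊕ q ⊜ (b ⊕ p) ⊕ c ⊕ q ⊕ a) ↭-refl
        [ a ] [ b ] [ c ] P Q)
      (↭-trans (++-cong σ (↭-trans (prep c υ) τ)) ρ)
    3≤ : 3 ≤ length (P ++ Q)
    -- The length bound 6 enters here: at least three vertices remain besides the triangle.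
    3≤ with s≤s (s≤s (s≤s 3≤)) ← subst (6 ≤_) (sym (↭-length perm)) 6≤ = 3≤

  absorb : ∀ {E} → Triangle a b c → (∀ {x y} → E x y → R x y ⊎ Joins a b x y) →
    Unique l → 6 ≤ length l → Closed E l →
    Equivalent (Closed R) l ⊎ Bad a b c l ⊎ Bad b a c l
  absorb {b = b} {c} {l} tri old uniq 6≤ closed
    with Reopening.reopen R-sym old uniq (≤-trans (s≤s (s≤s (s≤s z≤n))) 6≤) closed
  ... | inj₁ o = inj₁ (l , uniq , refl , o)
  ... | inj₂ ba
    -- A path leaves the set of vertices other than `c` exactly by arriving at `c`, so this decides
    -- whether `c` is on the cycle.
    with spread (λ z → ¬? (z ≟ c)) ba (λ { refl → B-irrefl refl (Triangle.bc tri) })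
  ... | inj₁ c∉ = inj₁ (absorb-off tri uniq 6≤ ba c∉)
  ... | inj₂ (exit {q = d} before _ edge d≡c after ρ)
    with refl ← decidable-stable (d ≟ c) d≡c =
    Sum.map₁ (λ o → l , uniq , refl , o) (absorb-on tri uniq 6≤ before edge after ρ)

  BadFor : (K : ℕ → Set ℓ) → V → V → V → Set ℓ
  BadFor K a b c = ∃[ l ] K (length l) × Unique l × Bad a b c l

  ClosedFor : (K : ℕ → Set ℓ) → Set ℓ
  ClosedFor K = ∃[ l ] K (length l) × Unique l × Closed R l

  Attempt : (K : ℕ → Set ℓ) → V → V → V → Set ℓ
  Attempt K a b c = ClosedFor K ⊎ BadFor K a b c ⊎ BadFor K b a c

  -- If no edge gives a cycle, one edge has a bad end and the edge opposite that end yields a second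
  -- bad vertex. The two may come from different admissible lengths.
  absorb-triangle : (K : ℕ → Set ℓ) → Triangle a b c →
    Attempt K a b c → Attempt K b c a → Attempt K c a b → ClosedFor K
  absorb-triangle {a = a} {b} {c} K tri = go
    where
    swapBad : ∀ {a b c} → BadFor K a b c → BadFor K a c b
    swapBad {a} {b} {c} (l , k , u , β) =
      l , k , u , record { Bad β ; perm = ↭-trans (prep a (swap c b ↭-refl)) (Bad.perm β) }
    both : ∀ {a b c} → Triangle a b c → BadFor K a b c → BadFor K b a c → ClosedFor K
    both tri (l , k , u , α) (_ , _ , u′ , β) with closed-of-two-bad tri u α u′ β
    ... | m , uₘ , len , o = m , subst K (sym len) k , uₘ , o
    go : Attempt K a b c → Attempt K b c a → Attempt K c a b → ClosedFor K
    go (inj₁ o) _ _ = o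
    go (inj₂ (inj₁ α)) (inj₁ o) _ = o
    go (inj₂ (inj₁ α)) (inj₂ (inj₁ β)) _ = both tri α (swapBad β)
    go (inj₂ (inj₁ α)) (inj₂ (inj₂ γ)) _ =
      both (mirror (rotate (rotate tri))) (swapBad α) (swapBad γ)
    go (inj₂ (inj₂ β)) _ (inj₁ o) = o
    go (inj₂ (inj₂ β)) _ (inj₂ (inj₁ γ)) = both (rotate tri) (swapBad β) (swapBad γ)
    go (inj₂ (inj₂ β)) _ (inj₂ (inj₂ α)) = both tri (swapBad α) β

-- Cycle subgraphs

lookup-injective : Unique l → ∀ i j → lookup l i ≡ lookup l j → i ≡ j
lookup-injective (f ∷ u) zero    zero    _ = refl
lookup-injective (f ∷ u) zero    (suc j) e = contradiction e (All.lookup f (∈-lookup j))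
lookup-injective (f ∷ u) (suc i) zero    e = contradiction (sym e) (All.lookup f (∈-lookup i))
lookup-injective (f ∷ u) (suc i) (suc j) e = cong suc (lookup-injective u i j e)

lookup-step : Path E x y l → ∀ i j → toℕ j ≡ suc (toℕ i) → E (lookup l i) (lookup l j)
lookup-step (stop _)         zero    zero          ()
lookup-step (_ ∷ _)          zero    zero          ()
lookup-step (_ ∷ _)          (suc _) zero          ()
lookup-step (e ∷ stop _)     zero    (suc zero)    _  = e
lookup-step (e ∷ _ ∷ _)      zero    (suc zero)    _  = e
lookup-step (e ∷ _ ∷ _)      zero    (suc (suc _)) ()
lookup-step (_ ∷ p)          (suc i) (suc j)       eq = lookup-step p i j (suc-injective eq)

lookup-first : Path E x y l → ∀ i → toℕ i ≡ 0 → lookup l i ≡ x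
lookup-first (stop _) zero _ = refl
lookup-first (_ ∷ _)  zero _ = refl

lookup-last : Path E x y l → ∀ i → suc (toℕ i) ≡ length l → lookup l i ≡ y
lookup-last (stop _)     zero    _  = refl
lookup-last (_ ∷ stop _) zero    ()
lookup-last (_ ∷ _ ∷ _)  zero    ()
lookup-last (_ ∷ p)      (suc i) eq = lookup-last p i (suc-injective eq)

-- Distinct ends are required in `adj` because `E` may be the complement of blue, which holds on the
-- diagonal.
closed⇒⊑ : ∀ H {E : Rel (Fin (order H)) 0ℓ} → (∀ {x y} → x ≢ y → E x y → Adj H x y) →
  ∀ {l} → Unique l → Closed E l → C (length l) ⊑ H
closed⇒⊑ H {E} adj uniq (x , y , (l , p , σ) , e) =
  subst (λ k → C k ⊑ H) (↭-length σ) (lookup l , (λ {i} {j} → lookup-injective uₗ i j) , preserves)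
  where
  uₗ : Unique l
  uₗ = Unique-resp-↭ (↭-sym σ) uniq
  next : ∀ i j → Next i j → E (lookup l i) (lookup l j)
  next i j (inj₁ j≡1+i)       = lookup-step p i j j≡1+i
  next i j (inj₂ (i≡k , j≡0)) =
    subst₂ E (sym (lookup-last p i i≡k)) (sym (lookup-first p j j≡0)) e
  preserves : ∀ {i j} → Adj (C (length l)) i j → Adj H (lookup l i) (lookup l j)
  preserves {i} {j} (i≢j , inj₁ n) = adj (i≢j ∘ lookup-injective uₗ i j) (next i j n)
  preserves {i} {j} (i≢j , inj₂ n) =
    adj-sym H (adj (i≢j ∘ sym ∘ lookup-injective uₗ j i) (next j i n))

tabulatePath : ∀ {n} (f : Fin (suc n) → V) → (∀ i → E (f (inject₁ i)) (f (suc i))) →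
  Path E (f zero) (f (fromℕ n)) (tabulate f)
tabulatePath {n = zero}  f e = stop (f zero)
tabulatePath {n = suc n} f e = e zero ∷ tabulatePath (f ∘ suc) (e ∘ suc)

⊑⇒closed : ∀ H {E : Rel (Fin (order H)) 0ℓ} → (∀ {x y} → Adj H x y → E x y) →
  ∀ {k} → 2 ≤ k → C k ⊑ H → ∃[ l ] length l ≡ k × Unique l × Closed E l
⊑⇒closed H adj {suc zero} (s≤s ())
⊑⇒closed H adj {suc (suc n)} _ (f , inj , hom) =
  tabulate f , length-tabulate f , Unique.tabulate⁺ inj ,
  _ , _ , (_ , tabulatePath f (adj ∘ hom ∘ step) , ↭-refl) ,
  adj (hom {fromℕ (suc n)} {zero} ((λ ()) , inj₁ (inj₂ (cong suc (toℕ-fromℕ (suc n)) , refl))))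
  where
  step : ∀ i → Adj (C (suc (suc n))) (inject₁ i) (suc i)
  step i = (λ eq → 1+n≢n (sym (trans (sym (toℕ-inject₁ i)) (cong toℕ eq)))) ,
    inj₁ (inj₁ (cong suc (sym (toℕ-inject₁ i))))

⊑-trans : ∀ {G H K} → G ⊑ H → H ⊑ K → G ⊑ K
⊑-trans (f , f-inj , f-hom) (g , g-inj , g-hom) = g ∘ f , f-inj ∘ g-inj , g-hom ∘ f-hom

≅⇒⊑ : ∀ {G H} → G ≅ H → G ⊑ H
≅⇒⊑ (f , e) = Inverse.to f , Injection.injective (↔⇒↣ f) , λ {i} {j} → Equivalence.to (e i j)

≅⇒⊒ : ∀ {G H} → G ≅ H → H ⊑ G
≅⇒⊒ {G} {H} (f , e) = Inverse.from f , Injection.injective (↔⇒↣ (↔-sym f)) ,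
  λ {i} {j} a → Equivalence.from (e _ _)
    (subst₂ (Adj H) (sym (Inverse.strictlyInverseˡ f i)) (sym (Inverse.strictlyInverseˡ f j)) a)

-- Recolouring red-blue graphs

module _ {N : ℕ} where

  Blue : RedBlueGraph N → Rel (Fin N) 0ℓ
  Blue X = Adj (X ⟦ blue ⟧)

  isBlue? : (c : Colour) → Dec (c ≡ blue)
  isBlue? red  = no λ ()
  isBlue? blue = yes refl

  Blue? : ∀ X → Decidable (Blue X)
  Blue? X i j = ¬? (i ≟ j) ×-dec isBlue? (colour X i j)

  ¬Blue⇒red : ∀ X {i j} → i ≢ j → ¬ Blue X i j → Adj (X ⟦ red ⟧) i j
  ¬Blue⇒red X {i} {j} i≢j ¬b with colour X i j
  ... | red  = i≢j , refl
  ... | blue = contradiction (i≢j , refl) ¬b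

  red⇒¬Blue : ∀ X {i j} → Adj (X ⟦ red ⟧) i j → ¬ Blue X i j
  red⇒¬Blue X (_ , r) (_ , b) with () ← trans (sym r) b

  Square : RedBlueGraph N → (w x y z : Fin N) → Set
  Square X w x y z =
    Blue X w x × Blue X x y × Blue X y z × Blue X z w × w ≢ y × x ≢ z

  square? : ∀ X → Dec (∃₂ λ w x → ∃₂ λ y z → Square X w x y z)
  square? X = any? λ w → any? λ x → any? λ y → any? λ z →
    Blue? X w x ×-dec Blue? X x y ×-dec Blue? X y z ×-dec Blue? X z w ×-dec
    ¬? (w ≟ y) ×-dec ¬? (x ≟ z)

  square⇒⊑ : ∀ X {w x y z} → Square X w x y z → C 4 ⊑ X ⟦ blue ⟧
  square⇒⊑ X {w} {x} {y} {z} (wx , xy , yz , zw , w≢y , x≢z) =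
    closed⇒⊑ (X ⟦ blue ⟧) (λ _ → id)
      ((proj₁ wx ∷ w≢y ∷ ≢-sym (proj₁ zw) ∷ []) ∷ (proj₁ xy ∷ x≢z ∷ []) ∷
        (proj₁ yz ∷ []) ∷ [] ∷ [])
      (w , z , (_ , wx ∷ xy ∷ yz ∷ stop z , ↭-refl) , zw)

  joins? : (a b : Fin N) → Decidable (Joins a b)
  joins? a b i j = (i ≟ a ×-dec j ≟ b) ⊎-dec (i ≟ b ×-dec j ≟ a)

  redden : RedBlueGraph N → Fin N → Fin N → RedBlueGraph N
  redden X a b = record
    { colour     = λ i j → if does (joins? a b i j) then red else colour X i j
    ; colour-sym = λ i j → cong₂ (if_then red else_) (symmetric i j) (colour-sym X i j)
    }
    where
    symmetric : ∀ i j → does (joins? a b i j) ≡ does (joins? a b j i)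
    symmetric i j = trans (∨-comm (does (i ≟ a) ∧ _) _)
      (cong₂ _∨_ (∧-comm (does (i ≟ b)) _) (∧-comm (does (i ≟ a)) _))

  unreddened : ∀ {A : Set} {c} (d : Dec A) → (if does d then red else c) ≡ blue → c ≡ blue × ¬ A
  unreddened (no ¬a) e = e , ¬a

  kept-blue : ∀ {A : Set} {c} (d : Dec A) → ¬ A → c ≡ blue → (if does d then red else c) ≡ blue
  kept-blue (yes a) ¬a e = contradiction a ¬a
  kept-blue (no _)  _  e = e

  redden-blue : ∀ X a b {i j} → Blue (redden X a b) i j → Blue X i j × ¬ Joins a b i j
  redden-blue X a b {i} {j} (i≢j , e) with e′ , ¬j ← unreddened (joins? a b i j) e = (i≢j , e′) , ¬j

  redden-old : ∀ X a b {i j} → ¬ Blue (redden X a b) i j → ¬ Blue X i j ⊎ Joins a b i j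
  redden-old X a b {i} {j} ¬b with joins? a b i j
  ... | yes j = inj₂ j
  ... | no ¬j = inj₁ λ (i≢j , e) → ¬b (i≢j , kept-blue (joins? a b _ _) ¬j e)

  -- Eliminating blue triangles by induction

  module _ {ℓ₁ ℓ₂} (𝒢₁ : GraphSet ℓ₁) (𝒢₂ : GraphSet ℓ₂)
    (long : ∀ {G} → 𝒢₁ G → ∃[ k ] 6 ≤ k × G ≅ C k) (C₄∈ : 𝒢₂ (C 4)) where

    LongLength : ℕ → Set _
    LongLength k = ∃[ G ] 𝒢₁ G × 6 ≤ k × G ≅ C k

    Good : RedBlueGraph N → Set _
    Good X = Contains (X ⟦ red ⟧) 𝒢₁ ⊎ Contains (X ⟦ blue ⟧) 𝒢₂

    RedCycle : RedBlueGraph N → Set _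
    RedCycle X = ∃[ l ] LongLength (length l) × Unique l × Closed (λ i j → ¬ Blue X i j) l

    contains⇒redCycle : ∀ X → Contains (X ⟦ red ⟧) 𝒢₁ → RedCycle X
    contains⇒redCycle X (G , G∈ , G⊑) with long G∈
    ... | k , 6≤ , G≅
      with ⊑⇒closed (X ⟦ red ⟧) (red⇒¬Blue X) (≤-trans (s≤s (s≤s z≤n)) 6≤)
             (⊑-trans {C k} {G} {X ⟦ red ⟧} (≅⇒⊒ {G} {C k} G≅) G⊑)
    ... | l , refl , u , o = l , (G , G∈ , 6≤ , G≅) , u , o

    redCycle⇒contains : ∀ X → RedCycle X → Contains (X ⟦ red ⟧) 𝒢₁
    redCycle⇒contains X (l , (G , G∈ , _ , G≅) , u , o) = G , G∈ ,
      ⊑-trans {G} {C (length l)} {X ⟦ red ⟧} (≅⇒⊑ {G} {C (length l)} G≅)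
        (closed⇒⊑ (X ⟦ red ⟧) (¬Blue⇒red X) u o)

    -- Induction on the length of a list that covers the blue edges, with `n` as a strict bound.
    -- Each edge of a blue triangle is recoloured separately, and the induction hypothesis is
    -- applied to each of the three results.
    remove-triangles : Arrows N 𝒢₁ (｛ C 3 ｝ ∪ 𝒢₂) →
      ∀ n X (es : List (Fin N × Fin N)) → length es < n →
      (∀ {i j} → Blue X i j → (i , j) ∈ es) → Good X
    remove-triangles arrows (suc n) X es (s≤s es≤n) listed with square? X
    ... | yes (_ , _ , _ , _ , sq) = inj₂ (C 4 , C₄∈ , square⇒⊑ X sq)
    ... | no ¬sq with arrows X
    ...   | inj₁ r = inj₁ r
    ...   | inj₂ (G , inj₂ G∈ , G⊑) = inj₂ (G , G∈ , G⊑)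
    ...   | inj₂ (_ , inj₁ refl , f , _ , hom) =
      combine tri (attempt tri) (attempt (rotate tri)) (attempt (rotate (rotate tri)))
      where
      open Absorption _≟_ (Blue X) (Blue? X) (λ {i} {j} → adj-sym (X ⟦ blue ⟧) {i} {j})
        (λ {i} {j} → adj-irrefl (X ⟦ blue ⟧) {i} {j})
        (λ wx xy yz zw w≢y x≢z → ¬sq (_ , _ , _ , _ , wx , xy , yz , zw , w≢y , x≢z))
      tri : Triangle (f zero) (f (suc zero)) (f (suc (suc zero)))
      tri = triangle
        (hom ((λ ()) , inj₁ (inj₁ refl)))
        (hom ((λ ()) , inj₁ (inj₁ refl)))
        (hom ((λ ()) , inj₁ (inj₂ (refl , refl))))
      Attempt′ : Fin N → Fin N → Fin N → Set _
      Attempt′ a b c = Contains (X ⟦ blue ⟧) 𝒢₂ ⊎ Attempt LongLength a b c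
      attempt : ∀ {a b c} → Triangle a b c → Attempt′ a b c
      attempt {a} {b} {c} t
        with remove-triangles arrows n (redden X a b)
               (filter kept? es) (<-≤-trans (filter-notAll kept? es dropped) es≤n) listed′
        where
        kept? : U.Decidable (λ (e : Fin N × Fin N) → ¬ Joins a b (proj₁ e) (proj₂ e))
        kept? (i , j) = ¬? (joins? a b i j)
        -- The pair `(a , b)` itself leaves the list, so its length strictly decreases.
        dropped : Any (U.∁ (λ (e : Fin N × Fin N) → ¬ Joins a b (proj₁ e) (proj₂ e))) es
        dropped = Any.map (λ { refl ¬j → ¬j (inj₁ (refl , refl)) }) (listed (Triangle.ab t))
        listed′ : ∀ {i j} → Blue (redden X a b) i j → (i , j) ∈ filter kept? es
        listed′ bl with b′ , ¬j ← redden-blue X a b bl = ∈-filter⁺ kept? (listed b′) ¬j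
      -- Recolouring creates no blue edge, so a blue member of `𝒢₂` was already in `X`.
      ... | inj₂ (G , G∈ , g , g-inj , g-hom) =
        inj₁ (G , G∈ , g , g-inj , λ e → proj₁ (redden-blue X a b (g-hom e)))
      ... | inj₁ cycle with contains⇒redCycle (redden X a b) cycle
      ... | l , k@(_ , _ , 6≤ , _) , u , o with absorb t (redden-old X a b) u 6≤ o
      ... | inj₁ (m , uₘ , len , o′) = inj₂ (inj₁ (m , subst LongLength (sym len) k , uₘ , o′))
      ... | inj₂ (inj₁ α) = inj₂ (inj₂ (inj₁ (l , k , u , α)))
      ... | inj₂ (inj₂ β) = inj₂ (inj₂ (inj₂ (l , k , u , β)))
      combine : ∀ {a b c} → Triangle a b c →
        Attempt′ a b c → Attempt′ b c a → Attempt′ c a b → Good X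
      combine _ (inj₁ β) _ _ = inj₂ β
      combine _ (inj₂ _) (inj₁ β) _ = inj₂ β
      combine _ (inj₂ _) (inj₂ _) (inj₁ β) = inj₂ β
      combine t (inj₂ α₁) (inj₂ α₂) (inj₂ α₃) =
        inj₁ (redCycle⇒contains X (absorb-triangle LongLength t α₁ α₂ α₃))

    arrows-without-C₃ : Arrows N 𝒢₁ (｛ C 3 ｝ ∪ 𝒢₂) → Arrows N 𝒢₁ 𝒢₂
    arrows-without-C₃ arrows X = remove-triangles arrows (suc (length pairs)) X pairs ≤-refl
      (λ _ → ∈-cartesianProduct⁺ (∈-allFin _) (∈-allFin _))
      where
      pairs : List (Fin N × Fin N)
      pairs = cartesianProduct (allFin N) (allFin N)

-- The same `N` satisfy both arrow relations: a larger family is easier to hit, and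
-- `arrows-without-C₃` is the converse.
ramsey-without-C₃ : ∀ {ℓ₁ ℓ₂} (𝒢₁ : GraphSet ℓ₁) (𝒢₂ : GraphSet ℓ₂) →
  (∀ {G} → 𝒢₁ G → ∃[ k ] 6 ≤ k × G ≅ C k) → 𝒢₂ (C 4) →
  ∀ R₁ R₂ → IsRamseyNumber 𝒢₁ 𝒢₂ R₁ → IsRamseyNumber 𝒢₁ (｛ C 3 ｝ ∪ 𝒢₂) R₂ → R₁ ≡ R₂
ramsey-without-C₃ 𝒢₁ 𝒢₂ long C₄∈ R₁ R₂ (1≤R₁ , arr₁ , least₁) (1≤R₂ , arr₂ , least₂) = ≤-antisym
  (least₁ R₂ 1≤R₂ (arrows-without-C₃ 𝒢₁ 𝒢₂ long C₄∈ arr₂))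
  (least₂ R₁ 1≤R₁ λ X → Sum.map₂ (λ (G , G∈ , G⊑) → G , inj₂ G∈ , G⊑) (arr₁ X))

corollary1p10 : ∀ {ℓ₁ ℓ₂ : Level} →
    (∀ (Γ₁ : GraphSet ℓ₁) (Γ₂ : GraphSet ℓ₂) →
    Satisfiable Γ₁ → Γ₁ ⊆ Cycle →
    Γ₂ ⊆ Cycle → LengthsAtLeast 5 Γ₂ →
    ∀ (R₁ R₂ : ℕ) →
    IsRamseyNumber Γ₁ (｛ C 4 ｝ ∪ Γ₂) R₁ →
    IsRamseyNumber Γ₁ (｛ C 3 ｝ ∪ ｛ C 4 ｝ ∪ Γ₂) R₂ →
    LengthsAtLeast 6 Γ₁ →
    R₁ ≡ R₂)
    ×
    (∀ (n : ℕ) → 6 ≤ n →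
    ∀ (R₁ R₂ : ℕ) →
    IsRamseyNumber ｛ C n ｝ ｛ C 4 ｝ R₁ →
    IsRamseyNumber ｛ C n ｝ (｛ C 3 ｝ ∪ ｛ C 4 ｝) R₂ →
    R₁ ≡ R₂)
corollary1p10 =
  (λ Γ₁ Γ₂ _ cycles _ _ R₁ R₂ isR₁ isR₂ long →
    ramsey-without-C₃ Γ₁ (｛ C 4 ｝ ∪ Γ₂)
      (λ G∈ → let k , 3≤k , G≅ = cycles G∈ in k , long G∈ (3≤k , G≅) , G≅)
      (inj₁ refl) R₁ R₂ isR₁ isR₂) ,
  (λ n 6≤n → ramsey-without-C₃ ｛ C n ｝ ｛ C 4 ｝
    (λ { refl → n , 6≤n , ↔-id _ , λ _ _ → ⇔-id _ }) refl)
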